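{- Let $V$ be a stochastic valuation. Then the map $\widehat V : L\to\mathbb R$ given by $\widehat V(\alpha)=\mathrm{Prob}_V(\alpha)$ is a probability assignment, i.e. for all $\alpha,\beta\in L$: (P1) $0\le \widehat V(\alpha)\le 1$; (P2) if $\vDash_c\alpha$ then $\widehat V(\alpha)=1$; (P3) if $\alpha\vDash_c\beta$ then $\widehat V(\alpha)\le\widehat V(\beta)$; (P4) if $\vDash_c\neg(\beta\wedge\alpha)$ then $\widehat V(\beta\vee\alpha)=\widehat V(\beta)+\widehat V(\alpha)$.
   Context: $B=\{B_j: j\in\mathbb N\}$ is a denumerable set of propositional symbols and $L$ is the set of propositional formulas generated from $B$ by the connectives $\neg$ and $\supset$; the other connectives, verum and falsum are the usual abbreviations. A valuation is a map $v:B\to\{0,1\}$, identified with the subset $\{B_j: v(B_j)=1\}$ of $B$. $v\Vdash_c\alpha$ denotes classical satisfaction; $\Delta\vDash_c\alpha$ means that every valuation satisfying all $\delta\in\Delta$ satisfies $\alpha$. $B_\alpha$ is the (finite, non-empty) set of symbols occurring in $\alpha$, and $[\![\alpha]\!]=\{v\cap B_\alpha : v\Vdash_c\alpha\}$. A stochastic valuation $V$ is a family $\{V_{B_j}\}_{B_j\in B}$ of random variables on a probability space $(\Omega,\mathcal F,\mu)$, where $V_{B_j}$ takes values in $\{\emptyset,\{B_j\}\}$ ($\emptyset$ standing for $0$/false, $\{B_j\}$ for $1$/true). For finite non-empty $A\subseteq B$ and $U\subseteq A$, $\mathrm{Prob}(V_A=U)=\mu\big(\bigcap_{B_j\in A}V_{B_j}^{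 -1}(U\cap\{B_j\})\big)$. For $\alpha\in L$, $\mathrm{Prob}_V(\alpha)=\sum_{U\in[\![\alpha]\!]}\mathrm{Prob}(V_{B_\alpha}=U)$. -}

module Defs where

open import Data.Bool.Base using (Bool; true; false; T; _∧_)
open import Data.Bool.Properties using (T?; T-∧) renaming (_≟_ to _≟ᵇ_)
open import Data.List.Base using (List; []; _∷_; [_]; _++_; map; filter; foldr; deduplicate)
open import Data.List.Membership.DecPropositional using () renaming (_∈?_ to mem?)
open import Data.List.Membership.Propositional using (_∈_)
open import Data.List.Membership.Propositional.Properties
  using (∈-++⁺ˡ; ∈-++⁺ʳ; ∈-deduplicate⁺)
open import Data.List.Relation.Unary.All as All using (All; []; _∷_)
open import Data.List.Relation.Unary.Any using (here)
open import Data.Nat.Base as ℕ using (ℕ; zero; suc)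
import Data.Nat.Properties as ℕ
open import Data.Product.Base using (∃; _×_; _,_; proj₁; proj₂)
open import Data.Rational.Base as ℚ using (ℚ; 0ℚ; 1ℚ; ½)
import Data.Rational.Properties as ℚ
open import Data.Rational.Solver using (module +-*-Solver)
open import Data.Sum.Base using (inj₁; inj₂)
open import Function.Base using (_∘_)
open import Function.Bundles using (Equivalence)
open import Level using (Level; 0ℓ) renaming (suc to lsuc; _⊔_ to _⊔ˡ_)
open import Relation.Binary.PropositionalEquality
  using (_≡_; _≢_; _≗_; refl; sym; trans; cong; subst)
open import Relation.Nullary using (¬_; Dec)
open import Relation.Nullary.Decidable
  using (⌊_⌋; map′; ¬?; _×-dec_; _→-dec_; decidable-stable; toWitness; fromWitness)
open import Relation.Unary using (Pred; Decidable; ∅; U; ∁; ⋃; _∩_; _≐_; _⊥_; ｛_｝)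

private variable
  a e : Level

------------------------------------------------------------------------
-- Real numbers: Cantor's construction, a setoid of Cauchy sequences of
-- rationals.

IsCauchy : (ℕ → ℚ) → Set
IsCauchy x = ∀ ε → 0ℚ ℚ.< ε →
  ∃ λ N → ∀ m n → N ℕ.≤ m → N ℕ.≤ n → ℚ.∣ x m ℚ.- x n ∣ ℚ.< ε

record ℝ : Set where
  constructor mkℝ
  field
    seq    : ℕ → ℚ
    cauchy : IsCauchy seq

open ℝ public

infix  4 _≈ᴿ_ _≤ᴿ_
infixl 6 _+ᴿ_ _-ᴿ_
infix  8 -ᴿ_

_≈ᴿ_ : ℝ → ℝ → Set
x ≈ᴿ y = ∀ ε → 0ℚ ℚ.< ε →
  ∃ λ N → ∀ n → N ℕ.≤ n → ℚ.∣ seq x n ℚ.- seq y n ∣ ℚ.< ε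

_≤ᴿ_ : ℝ → ℝ → Set
x ≤ᴿ y = ∀ ε → 0ℚ ℚ.< ε →
  ∃ λ N → ∀ n → N ℕ.≤ n → seq x n ℚ.< seq y n ℚ.+ ε

fromℚ : ℚ → ℝ
fromℚ q = mkℝ (λ _ → q) λ ε 0<ε →
  0 , λ _ _ _ _ → subst (ℚ._< ε) (sym (cong ℚ.∣_∣ (ℚ.+-inverseʳ q))) 0<ε

0ᴿ 1ᴿ : ℝ
0ᴿ = fromℚ 0ℚ
1ᴿ = fromℚ 1ℚ

private
  half-pos : ∀ {ε} → 0ℚ ℚ.< ε → 0ℚ ℚ.< ½ ℚ.* ε
  half-pos 0<ε = ℚ.*-monoʳ-<-pos ½ 0<ε

  half+half : ∀ ε → ½ ℚ.* ε ℚ.+ ½ ℚ.* ε ≡ ε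
  half+half ε = trans (sym (ℚ.*-distribʳ-+ ε ½ ½)) (ℚ.*-identityˡ ε)

  open +-*-Solver using (solve; _:=_; _:+_; :-_)

  regroup : ∀ p q r s → (p ℚ.+ q) ℚ.- (r ℚ.+ s) ≡ (p ℚ.- r) ℚ.+ (q ℚ.- s)
  regroup = solve 4 (λ p q r s →
    (p :+ q) :+ (:- (r :+ s)) := (p :+ (:- r)) :+ (q :+ (:- s))) refl

  neg-diff : ∀ p q → (ℚ.- p) ℚ.- (ℚ.- q) ≡ ℚ.- (p ℚ.- q)
  neg-diff = solve 2 (λ p q →
    (:- p) :+ (:- (:- q)) := :- (p :+ (:- q))) refl

  split-diff : ∀ p q → p ≡ (p ℚ.- q) ℚ.+ q
  split-diff = solve 2 (λ p q → p := (p :+ (:- q)) :+ q) refl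

  add-sub : ∀ p q → (p ℚ.+ q) ℚ.- q ≡ p
  add-sub = solve 2 (λ p q → (p :+ q) :+ (:- q) := p) refl

  flip-diff : ∀ p q → ℚ.- (p ℚ.- q) ≡ q ℚ.- p
  flip-diff = solve 2 (λ p q → :- (p :+ (:- q)) := q :+ (:- p)) refl

  ∣p∣-∣q∣≤∣p-q∣ : ∀ p q → ℚ.∣ p ∣ ℚ.- ℚ.∣ q ∣ ℚ.≤ ℚ.∣ p ℚ.- q ∣
  ∣p∣-∣q∣≤∣p-q∣ p q = begin
    ℚ.∣ p ∣ ℚ.- ℚ.∣ q ∣
      ≡⟨ cong (λ t → ℚ.∣ t ∣ ℚ.- ℚ.∣ q ∣) (split-diff p q) ⟩
    ℚ.∣ (p ℚ.- q) ℚ.+ q ∣ ℚ.- ℚ.∣ q ∣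
      ≤⟨ ℚ.+-monoˡ-≤ (ℚ.- ℚ.∣ q ∣) (ℚ.∣p+q∣≤∣p∣+∣q∣ (p ℚ.- q) q) ⟩
    (ℚ.∣ p ℚ.- q ∣ ℚ.+ ℚ.∣ q ∣) ℚ.- ℚ.∣ q ∣
      ≡⟨ add-sub ℚ.∣ p ℚ.- q ∣ ℚ.∣ q ∣ ⟩
    ℚ.∣ p ℚ.- q ∣ ∎
    where open ℚ.≤-Reasoning

  ∣∣p∣-∣q∣∣≤∣p-q∣ : ∀ p q → ℚ.∣ ℚ.∣ p ∣ ℚ.- ℚ.∣ q ∣ ∣ ℚ.≤ ℚ.∣ p ℚ.- q ∣
  ∣∣p∣-∣q∣∣≤∣p-q∣ p q with ℚ.∣p∣≡p∨∣p∣≡-p (ℚ.∣ p ∣ ℚ.- ℚ.∣ q ∣)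
  ... | inj₁ eq = subst (ℚ._≤ ℚ.∣ p ℚ.- q ∣) (sym eq) (∣p∣-∣q∣≤∣p-q∣ p q)
  ... | inj₂ eq = begin
    ℚ.∣ ℚ.∣ p ∣ ℚ.- ℚ.∣ q ∣ ∣   ≡⟨ eq ⟩
    ℚ.- (ℚ.∣ p ∣ ℚ.- ℚ.∣ q ∣)   ≡⟨ flip-diff ℚ.∣ p ∣ ℚ.∣ q ∣ ⟩
    ℚ.∣ q ∣ ℚ.- ℚ.∣ p ∣         ≤⟨ ∣p∣-∣q∣≤∣p-q∣ q p ⟩
    ℚ.∣ q ℚ.- p ∣               ≡⟨ cong ℚ.∣_∣ (flip-diff p q) ⟨
    ℚ.∣ ℚ.- (p ℚ.- q) ∣         ≡⟨ ℚ.∣-p∣≡∣p∣ (p ℚ.- q) ⟩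
    ℚ.∣ p ℚ.- q ∣ ∎
    where open ℚ.≤-Reasoning

_+ᴿ_ : ℝ → ℝ → ℝ
x +ᴿ y = mkℝ (λ n → seq x n ℚ.+ seq y n) λ ε 0<ε →
  let N , p = cauchy x (½ ℚ.* ε) (half-pos 0<ε)
      M , q = cauchy y (½ ℚ.* ε) (half-pos 0<ε)
  in N ℕ.⊔ M , λ m n N⊔M≤m N⊔M≤n → begin-strict
    ℚ.∣ (seq x m ℚ.+ seq y m) ℚ.- (seq x n ℚ.+ seq y n) ∣
      ≡⟨ cong ℚ.∣_∣ (regroup (seq x m) (seq y m) (seq x n) (seq y n)) ⟩
    ℚ.∣ (seq x m ℚ.- seq x n) ℚ.+ (seq y m ℚ.- seq y n) ∣
      ≤⟨ ℚ.∣p+q∣≤∣p∣+∣q∣ (seq x m ℚ.- seq x n) (seq y m ℚ.- seq y n) ⟩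
    ℚ.∣ seq x m ℚ.- seq x n ∣ ℚ.+ ℚ.∣ seq y m ℚ.- seq y n ∣
      <⟨ ℚ.+-mono-<
           (p m n (ℕ.≤-trans (ℕ.m≤m⊔n N M) N⊔M≤m) (ℕ.≤-trans (ℕ.m≤m⊔n N M) N⊔M≤n))
           (q m n (ℕ.≤-trans (ℕ.m≤n⊔m N M) N⊔M≤m) (ℕ.≤-trans (ℕ.m≤n⊔m N M) N⊔M≤n)) ⟩
    ½ ℚ.* ε ℚ.+ ½ ℚ.* ε
      ≡⟨ half+half ε ⟩
    ε ∎
  where open ℚ.≤-Reasoning

-ᴿ_ : ℝ → ℝ
-ᴿ x = mkℝ (λ n → ℚ.- seq x n) λ ε 0<ε →
  let N , p = cauchy x ε 0<ε
  in N , λ m n N≤m N≤n → subst (ℚ._< ε)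
       (sym (trans (cong ℚ.∣_∣ (neg-diff (seq x m) (seq x n)))
                   (ℚ.∣-p∣≡∣p∣ (seq x m ℚ.- seq x n))))
       (p m n N≤m N≤n)

_-ᴿ_ : ℝ → ℝ → ℝ
x -ᴿ y = x +ᴿ (-ᴿ y)

∣_∣ᴿ : ℝ → ℝ
∣ x ∣ᴿ = mkℝ (λ n → ℚ.∣ seq x n ∣) λ ε 0<ε →
  let N , p = cauchy x ε 0<ε
  in N , λ m n N≤m N≤n →
       ℚ.≤-<-trans (∣∣p∣-∣q∣∣≤∣p-q∣ (seq x m) (seq x n)) (p m n N≤m N≤n)

partialSum : (ℕ → ℝ) → ℕ → ℝ
partialSum x zero    = 0ᴿ
partialSum x (suc n) = partialSum x n +ᴿ x n

-- Rational ε suffice: every positive real exceeds a positive rational.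
ConvergesTo : (ℕ → ℝ) → ℝ → Set
ConvergesTo s l = ∀ ε → 0ℚ ℚ.< ε →
  ∃ λ N → ∀ n → N ℕ.≤ n → ∣ s n -ᴿ l ∣ᴿ ≤ᴿ fromℚ ε

∑ : {A : Set a} → List A → (A → ℝ) → ℝ
∑ xs f = foldr (λ x s → f x +ᴿ s) 0ᴿ xs

------------------------------------------------------------------------
-- Probability spaces

-- A subset of Ω is a predicate, and two predicates are the same subset
-- when they are extensionally equal (_≐_); hence the fields resp and cong.
record SigmaAlgebra (Ω : Set a) (e : Level) : Set (a ⊔ˡ lsuc e) where
  field
    IsEvent : Pred Ω 0ℓ → Set e
    resp    : ∀ {A B} → A ≐ B → IsEvent A → IsEvent B
    U-event : IsEvent U
    ∁-event : ∀ {A} → IsEvent A → IsEvent (∁ A)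
    ⋃-event : ∀ {A : ℕ → Pred Ω 0ℓ} → (∀ i → IsEvent (A i)) → IsEvent (⋃ ℕ A)

record ProbabilitySpace (a e : Level) : Set (lsuc (a ⊔ˡ e)) where
  field
    Ω : Set a
    𝓕 : SigmaAlgebra Ω e
  open SigmaAlgebra 𝓕 public
  field
    μ          : ∀ A → IsEvent A → ℝ
    μ-cong     : ∀ {A B} (p : IsEvent A) (q : IsEvent B) → A ≐ B → μ A p ≈ᴿ μ B q
    μ-nonneg   : ∀ {A} (p : IsEvent A) → 0ᴿ ≤ᴿ μ A p
    μ-U        : μ U U-event ≈ᴿ 1ᴿ
    μ-additive : ∀ {A : ℕ → Pred Ω 0ℓ} (p : ∀ i → IsEvent (A i)) →
                 (∀ i j → i ≢ j → A i ⊥ A j) →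
                 ConvergesTo (partialSum λ i → μ (A i) (p i))
                             (μ (⋃ ℕ A) (⋃-event p))

module _ {Ω : Set a} (𝓕 : SigmaAlgebra Ω e) where
  open SigmaAlgebra 𝓕

  -- Decidability gives A ∩ B ≐ ∁ (∁ A ∪ ∁ B) without excluded middle.
  ∩-event : ∀ {A B : Pred Ω 0ℓ} → Decidable A → Decidable B →
            IsEvent A → IsEvent B → IsEvent (A ∩ B)
  ∩-event {A} {B} A? B? p q = resp (to , from) (∁-event (⋃-event C-event))
    where
    C : ℕ → Pred Ω 0ℓ
    C zero    = ∁ A
    C (suc _) = ∁ B

    C-event : ∀ i → IsEvent (C i)
    C-event zero    = ∁-event p
    C-event (suc _) = ∁-event q

    to : ∀ {ω} → ∁ (⋃ ℕ C) ω → (A ∩ B) ω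
    to {ω} h = decidable-stable (A? ω) (λ ¬A → h (0 , ¬A))
             , decidable-stable (B? ω) (λ ¬B → h (1 , ¬B))

    from : ∀ {ω} → (A ∩ B) ω → ∁ (⋃ ℕ C) ω
    from (Aω , _) (zero  , ¬A) = ¬A Aω
    from (_ , Bω) (suc _ , ¬B) = ¬B Bω

------------------------------------------------------------------------
-- Propositional logic

-- The symbol B_j is represented by its index j.
infix  9 ∼_
infixr 6 _⊃_
infixr 7 _∨ᴸ_
infixr 8 _∧ᴸ_

data L : Set where
  atom : ℕ → L
  ∼_   : L → L
  _⊃_  : L → L → L

_∨ᴸ_ _∧ᴸ_ : L → L → L
α ∨ᴸ β = ∼ α ⊃ β
α ∧ᴸ β = ∼ (α ⊃ ∼ β)

-- A valuation, identified with the set of symbols it makes true.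
Valuation : Set
Valuation = ℕ → Bool

infix 4 _⊩_ _⊩?_ _⊨_

_⊩_ : Valuation → L → Set
v ⊩ atom j = T (v j)
v ⊩ ∼ α    = ¬ (v ⊩ α)
v ⊩ α ⊃ β  = v ⊩ α → v ⊩ β

_⊩?_ : ∀ v α → Dec (v ⊩ α)
v ⊩? atom j  = T? (v j)
v ⊩? ∼ α     = ¬? (v ⊩? α)
v ⊩? (α ⊃ β) = (v ⊩? α) →-dec (v ⊩? β)

_⊨_ : Pred L 0ℓ → L → Set
Δ ⊨ α = ∀ v → (∀ δ → Δ δ → v ⊩ δ) → v ⊩ α

-- Finite sets of symbols are lists; χ turns such a set into a valuation.
_∈?_ : ∀ j (A : List ℕ) → Dec (j ∈ A)
_∈?_ = mem? ℕ._≟_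

χ : List ℕ → Valuation
χ A j = ⌊ j ∈? A ⌋

_∩ᵛ_ : Valuation → List ℕ → Valuation
(v ∩ᵛ A) j = v j ∧ χ A j

occurrences : L → List ℕ
occurrences (atom j) = [ j ]
occurrences (∼ α)    = occurrences α
occurrences (α ⊃ β)  = occurrences α ++ occurrences β

-- B_α
symbols : L → List ℕ
symbols α = deduplicate ℕ._≟_ (occurrences α)

-- For a duplicate-free list A, each subset of A is listed exactly once.
subsets : List ℕ → List (List ℕ)
subsets []      = [ [] ]
subsets (j ∷ A) = subsets A ++ map (j ∷_) (subsets A)

-- The finite set S belongs to ⟦ α ⟧ = { v ∩ B_α : v ⊩ α }.
⟦_⟧ : L → Pred (List ℕ) 0ℓ
⟦ α ⟧ S = ∃ λ v → (v ⊩ α) × (χ S ≗ v ∩ᵛ symbols α)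

private
  T-cong : ∀ {b c} → b ≡ c → T b → T c
  T-cong refl t = t

  χ⁺ : ∀ {j} A → j ∈ A → T (χ A j)
  χ⁺ {j} A j∈A = fromWitness {a? = j ∈? A} j∈A

  χ⁻ : ∀ {j} A → T (χ A j) → j ∈ A
  χ⁻ {j} A t = toWitness {a? = j ∈? A} t

  T-ext : ∀ {b c} → (T b → T c) → (T c → T b) → b ≡ c
  T-ext {false} {false} _ _ = refl
  T-ext {true}  {true}  _ _ = refl
  T-ext {true}  {false} f _ with () ← f _
  T-ext {false} {true}  _ g with () ← g _

  ∧-χ : ∀ v A {j} → j ∈ A → (v ∩ᵛ A) j ≡ v j
  ∧-χ v A {j} j∈A = T-ext
    (λ t → proj₁ (Equivalence.to (T-∧ {v j} {χ A j}) t))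
    (λ t → Equivalence.from (T-∧ {v j} {χ A j}) (t , χ⁺ A j∈A))

  coincidence : ∀ {v w} α → (∀ {j} → j ∈ occurrences α → v j ≡ w j) →
                ((v ⊩ α → w ⊩ α) × (w ⊩ α → v ⊩ α))
  coincidence (atom j) h = T-cong (h (here refl)) , T-cong (sym (h (here refl)))
  coincidence (∼ α)    h =
    let to , from = coincidence α h in (λ f → f ∘ from) , (λ f → f ∘ to)
  coincidence (α ⊃ β)  h =
    let to₁ , from₁ = coincidence α (h ∘ ∈-++⁺ˡ)
        to₂ , from₂ = coincidence β (h ∘ ∈-++⁺ʳ (occurrences α))
    in (λ f → to₂ ∘ f ∘ from₁) , (λ f → from₂ ∘ f ∘ to₁)

⟦_⟧? : ∀ α → Decidable ⟦ α ⟧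
⟦ α ⟧? S = map′ sound complete ((χ S ⊩? α) ×-dec All.all? (_∈? symbols α) S)
  where
  sound : (χ S ⊩ α) × All (_∈ symbols α) S → ⟦ α ⟧ S
  sound (sat , sub) = χ S , sat , λ j → T-ext
    (λ t → Equivalence.from (T-∧ {χ S j} {χ (symbols α) j})
             (t , χ⁺ (symbols α) (All.lookup sub (χ⁻ S t))))
    (λ t → proj₁ (Equivalence.to (T-∧ {χ S j} {χ (symbols α) j}) t))

  complete : ⟦ α ⟧ S → (χ S ⊩ α) × All (_∈ symbols α) S
  complete (v , sat , eq)
    = proj₂ (coincidence α λ {j} j∈α →
        trans (eq j) (∧-χ v (symbols α) (∈-deduplicate⁺ ℕ._≟_ j∈α))) sat
    , All.tabulate λ {j} j∈S →
        χ⁻ (symbols α)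
          (proj₂ (Equivalence.to (T-∧ {v j} {χ (symbols α) j})
                   (T-cong (eq j) (χ⁺ S j∈S))))

------------------------------------------------------------------------
-- Stochastic valuations

-- The two values ∅ and {B_j} of the random variable V_{B_j} are encoded
-- as false and true; measurability is stated on these two points.
record StochasticValuation (P : ProbabilitySpace a e) : Set (a ⊔ˡ e) where
  open ProbabilitySpace P
  field
    V          : ℕ → Ω → Bool
    measurable : ∀ j b → IsEvent (λ ω → V j ω ≡ b)

module _ {P : ProbabilitySpace a e} (𝐕 : StochasticValuation P) where
  open ProbabilitySpace P
  open StochasticValuation 𝐕

  -- The event V_A = S, that is ⋂_{B_j ∈ A} V_{B_j}⁻¹(S ∩ {B_j}): under the
  -- encoding above, S ∩ {B_j} is χ S j.
  cylinder : List ℕ → List ℕ → Pred Ω 0ℓ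
  cylinder A S ω = All (λ j → V j ω ≡ χ S j) A

  cylinder-event : ∀ A S → IsEvent (cylinder A S)
  cylinder-event []      S = resp ((λ _ → []) , λ _ → _) U-event
  cylinder-event (j ∷ A) S = resp
    ((λ (h , hs) → h ∷ hs) , λ { (h ∷ hs) → h , hs })
    (∩-event 𝓕 (λ ω → V j ω ≟ᵇ χ S j)
               (λ ω → All.all? (λ k → V k ω ≟ᵇ χ S k) A)
               (measurable j (χ S j)) (cylinder-event A S))

  ℙ[V_≡_] : List ℕ → List ℕ → ℝ
  ℙ[V A ≡ S ] = μ (cylinder A S) (cylinder-event A S)

  Prob : L → ℝ
  Prob α = ∑ (filter ⟦ α ⟧? (subsets (symbols α))) λ S → ℙ[V symbols α ≡ S ]

record IsProbabilityAssignment (f : L → ℝ) : Set where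
  field
    P1 : ∀ α → (0ᴿ ≤ᴿ f α) × (f α ≤ᴿ 1ᴿ)
    P2 : ∀ α → ∅ ⊨ α → f α ≈ᴿ 1ᴿ
    P3 : ∀ α β → ｛ α ｝ ⊨ β → f α ≤ᴿ f β
    P4 : ∀ α β → ∅ ⊨ ∼ (β ∧ᴸ α) → f (β ∨ᴸ α) ≈ᴿ f β +ᴿ f α

{-# OPTIONS --safe #-}

-- The proof identifies Prob α with the measure of the event {ω | V(ω) ⊩ α}:
-- the cylinders V_{B_α} = S, for S in ⟦ α ⟧, partition this event.  Under this
-- identification P1–P4 are the boundedness, normalisation, monotonicity and
-- finite additivity of μ.  All events involved are decidable, so nothing
-- classical is needed.

module Submission where

open import Data.Bool.Base using (true; false; T; _∧_)
open import Data.Bool.Properties using (T?; T-≡; ∧-identityʳ)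
open import Data.Empty using (⊥-elim)
open import Data.List.Base using (List; []; _∷_; map; filter)
open import Data.List.Membership.Propositional using (_∈_; _∉_; find; lose)
open import Data.List.Membership.Propositional.Properties
  using (∈-++⁺ˡ; ∈-++⁺ʳ; ∈-++⁻; ∈-map⁺; ∈-map⁻; ∈-filter⁺; ∈-filter⁻; ∈-deduplicate⁺)
open import Data.List.Properties using (filter-accept; filter-reject)
open import Data.List.Relation.Binary.Subset.Propositional using (_⊆_)
open import Data.List.Relation.Unary.All as All using ([]; _∷_)
open import Data.List.Relation.Unary.AllPairs as AllPairs using (AllPairs; []; _∷_)
import Data.List.Relation.Unary.AllPairs.Properties as AllPairs
open import Data.List.Relation.Unary.Any as Any using (Any; here; there)
open import Data.List.Relation.Unary.Unique.DecPropositional.Properties using (deduplicate-!)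
open import Data.List.Relation.Unary.Unique.Propositional using (Unique)
open import Data.Nat.Base as ℕ using (ℕ; suc)
import Data.Nat.Properties as ℕ
open import Data.Product.Base using (∃; _×_; _,_; proj₁)
open import Data.Rational.Base as ℚ using (0ℚ; ½)
import Data.Rational.Properties as ℚ
open import Data.Rational.Solver using (module +-*-Solver)
open import Data.Sum.Base using (inj₁; inj₂)
open import Function.Base using (_∘_)
open import Function.Bundles using (Equivalence; mk⇔)
open import Level using (Level; 0ℓ)
open import Relation.Binary.Bundles using (Preorder)
open import Relation.Binary.Core using (Rel)
open import Relation.Binary.PropositionalEquality
  using (_≡_; _≢_; _≗_; refl; sym; trans; cong; subst)
open import Relation.Nullary using (yes; no)
open import Relation.Nullary.Decidable
  using (_×-dec_; ¬?; isYes≗does; does-⇔; dec-true; dec-false; decidable-stable)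
open import Relation.Unary using (Pred; Decidable; ∅; U; ∁; ⋃; _∩_; _∪_; _≐_; _⊥_)
  renaming (_⊆_ to _⊆ᵖ_)
open import Defs

private variable
  a e : Level

-- Real numbers

½-pos : ∀ {ε} → 0ℚ ℚ.< ε → 0ℚ ℚ.< ½ ℚ.* ε
½-pos = ℚ.*-monoʳ-<-pos ½

½ε+½ε≡ε : ∀ ε → ½ ℚ.* ε ℚ.+ ½ ℚ.* ε ≡ ε
½ε+½ε≡ε ε = trans (sym (ℚ.*-distribʳ-+ ε ½ ½)) (ℚ.*-identityˡ ε)

p≤∣p∣ : ∀ p → p ℚ.≤ ℚ.∣ p ∣
p≤∣p∣ p with ℚ.≤-total 0ℚ p
... | inj₁ 0≤p = ℚ.≤-reflexive (sym (ℚ.0≤p⇒∣p∣≡p 0≤p))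
... | inj₂ p≤0 = ℚ.≤-trans p≤0 (ℚ.0≤∣p∣ p)

p-q+q≡p : ∀ p q → (p ℚ.- q) ℚ.+ q ≡ p
p-q+q≡p = solve 2 (λ p q → (p :+ (:- q)) :+ q := p) refl
  where open +-*-Solver

∣p-q∣<ε⇒p<q+ε : ∀ p q {ε} → ℚ.∣ p ℚ.- q ∣ ℚ.< ε → p ℚ.< q ℚ.+ ε
∣p-q∣<ε⇒p<q+ε p q {ε} h = begin-strict
  p                    ≡⟨ p-q+q≡p p q ⟨
  (p ℚ.- q) ℚ.+ q      <⟨ ℚ.+-monoˡ-< q (ℚ.≤-<-trans (p≤∣p∣ (p ℚ.- q)) h) ⟩
  ε ℚ.+ q              ≡⟨ ℚ.+-comm ε q ⟩
  q ℚ.+ ε              ∎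
  where open ℚ.≤-Reasoning

p<q+ε⇒p-q<ε : ∀ p q {ε} → p ℚ.< q ℚ.+ ε → p ℚ.- q ℚ.< ε
p<q+ε⇒p-q<ε p q {ε} h = subst (p ℚ.- q ℚ.<_)
  (solve 2 (λ q ε → (q :+ ε) :+ (:- q) := ε) refl q ε) (ℚ.+-monoˡ-< (ℚ.- q) h)
  where open +-*-Solver

-[p-q]≡q-p : ∀ p q → ℚ.- (p ℚ.- q) ≡ q ℚ.- p
-[p-q]≡q-p = solve 2 (λ p q → :- (p :+ (:- q)) := q :+ (:- p)) refl
  where open +-*-Solver

∣p-q∣<ε : ∀ p q {ε} → p ℚ.< q ℚ.+ ε → q ℚ.< p ℚ.+ ε → ℚ.∣ p ℚ.- q ∣ ℚ.< ε
∣p-q∣<ε p q {ε} p<q+ε q<p+ε with ℚ.∣p∣≡p∨∣p∣≡-p (p ℚ.- q)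
... | inj₁ eq = subst (ℚ._< ε) (sym eq) (p<q+ε⇒p-q<ε p q p<q+ε)
... | inj₂ eq = subst (ℚ._< ε) (sym (trans eq (-[p-q]≡q-p p q))) (p<q+ε⇒p-q<ε q p q<p+ε)

∣p-q∣≡∣q-p∣ : ∀ p q → ℚ.∣ p ℚ.- q ∣ ≡ ℚ.∣ q ℚ.- p ∣
∣p-q∣≡∣q-p∣ p q = trans (sym (ℚ.∣-p∣≡∣p∣ (p ℚ.- q))) (cong ℚ.∣_∣ (-[p-q]≡q-p p q))

-- `_≈ᴿ_` and `_≤ᴿ_` see a real only through `seq`, which does not determine its `cauchy` component;
-- hence the implicit arguments written out in most later uses.
≤-≤⇒≈ : ∀ {x y} → x ≤ᴿ y → y ≤ᴿ x → x ≈ᴿ y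
≤-≤⇒≈ {x} {y} x≤y y≤x ε 0<ε =
  let N , p = x≤y ε 0<ε
      M , q = y≤x ε 0<ε
  in N ℕ.⊔ M , λ n N⊔M≤n →
       ∣p-q∣<ε (seq x n) (seq y n) (p n (ℕ.m⊔n≤o⇒m≤o N M N⊔M≤n)) (q n (ℕ.m⊔n≤o⇒n≤o N M N⊔M≤n))

≈⇒≤ : ∀ {x y} → x ≈ᴿ y → x ≤ᴿ y
≈⇒≤ {x} {y} x≈y ε 0<ε =
  let N , p = x≈y ε 0<ε in N , λ n N≤n → ∣p-q∣<ε⇒p<q+ε (seq x n) (seq y n) (p n N≤n)

≈-sym : ∀ {x y} → x ≈ᴿ y → y ≈ᴿ x
≈-sym {x} {y} x≈y ε 0<ε =
  let N , p = x≈y ε 0<ε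
  in N , λ n N≤n → subst (ℚ._< ε) (∣p-q∣≡∣q-p∣ (seq x n) (seq y n)) (p n N≤n)

≗⇒≈ : ∀ {x y} → seq x ≗ seq y → x ≈ᴿ y
≗⇒≈ {x} {y} h ε 0<ε = 0 , λ n _ →
  subst (ℚ._< ε)
    (sym (cong ℚ.∣_∣ (trans (cong (ℚ._- seq y n) (h n)) (ℚ.+-inverseʳ (seq y n))))) 0<ε

≤-trans : ∀ {x y z} → x ≤ᴿ y → y ≤ᴿ z → x ≤ᴿ z
≤-trans {x} {y} {z} x≤y y≤z ε 0<ε =
  let N , p = x≤y (½ ℚ.* ε) (½-pos 0<ε)
      M , q = y≤z (½ ℚ.* ε) (½-pos 0<ε)
  in N ℕ.⊔ M , λ n N⊔M≤n → begin-strict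
    seq x n
      <⟨ p n (ℕ.m⊔n≤o⇒m≤o N M N⊔M≤n) ⟩
    seq y n ℚ.+ ½ ℚ.* ε
      <⟨ ℚ.+-monoˡ-< (½ ℚ.* ε) (q n (ℕ.m⊔n≤o⇒n≤o N M N⊔M≤n)) ⟩
    (seq z n ℚ.+ ½ ℚ.* ε) ℚ.+ ½ ℚ.* ε
      ≡⟨ ℚ.+-assoc (seq z n) (½ ℚ.* ε) (½ ℚ.* ε) ⟩
    seq z n ℚ.+ (½ ℚ.* ε ℚ.+ ½ ℚ.* ε)
      ≡⟨ cong (seq z n ℚ.+_) (½ε+½ε≡ε ε) ⟩
    seq z n ℚ.+ ε ∎
  where open ℚ.≤-Reasoning

+-mono-≤ : ∀ {x y u v} → x ≤ᴿ y → u ≤ᴿ v → x +ᴿ u ≤ᴿ y +ᴿ v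
+-mono-≤ {x} {y} {u} {v} x≤y u≤v ε 0<ε =
  let N , p = x≤y (½ ℚ.* ε) (½-pos 0<ε)
      M , q = u≤v (½ ℚ.* ε) (½-pos 0<ε)
  in N ℕ.⊔ M , λ n N⊔M≤n → begin-strict
    seq x n ℚ.+ seq u n
      <⟨ ℚ.+-mono-< (p n (ℕ.m⊔n≤o⇒m≤o N M N⊔M≤n)) (q n (ℕ.m⊔n≤o⇒n≤o N M N⊔M≤n)) ⟩
    (seq y n ℚ.+ ½ ℚ.* ε) ℚ.+ (seq v n ℚ.+ ½ ℚ.* ε)
      ≡⟨ solve 3 (λ p q r → (p :+ r) :+ (q :+ r) := (p :+ q) :+ (r :+ r)) refl
           (seq y n) (seq v n) (½ ℚ.* ε) ⟩
    (seq y n ℚ.+ seq v n) ℚ.+ (½ ℚ.* ε ℚ.+ ½ ℚ.* ε)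
      ≡⟨ cong ((seq y n ℚ.+ seq v n) ℚ.+_) (½ε+½ε≡ε ε) ⟩
    (seq y n ℚ.+ seq v n) ℚ.+ ε ∎
  where
  open ℚ.≤-Reasoning
  open +-*-Solver using (solve; _:=_; _:+_)

≈-trans : ∀ {x y z} → x ≈ᴿ y → y ≈ᴿ z → x ≈ᴿ z
≈-trans {x} {y} {z} x≈y y≈z = ≤-≤⇒≈ {x} {z}
  (≤-trans {x} {y} {z} (≈⇒≤ {x} {y} x≈y) (≈⇒≤ {y} {z} y≈z))
  (≤-trans {z} {y} {x} (≈⇒≤ {z} {y} (≈-sym {y} {z} y≈z)) (≈⇒≤ {y} {x} (≈-sym {x} {y} x≈y)))

+-cong : ∀ {x y u v} → x ≈ᴿ y → u ≈ᴿ v → x +ᴿ u ≈ᴿ y +ᴿ v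
+-cong {x} {y} {u} {v} x≈y u≈v = ≤-≤⇒≈ {x +ᴿ u} {y +ᴿ v}
  (+-mono-≤ {x} {y} {u} {v} (≈⇒≤ {x} {y} x≈y) (≈⇒≤ {u} {v} u≈v))
  (+-mono-≤ {y} {x} {v} {u} (≈⇒≤ {y} {x} (≈-sym {x} {y} x≈y)) (≈⇒≤ {v} {u} (≈-sym {u} {v} u≈v)))

ℝ-preorder : Preorder 0ℓ 0ℓ 0ℓ
ℝ-preorder = record
  { Carrier = ℝ ; _≈_ = _≈ᴿ_ ; _≲_ = _≤ᴿ_
  ; isPreorder = record
    { isEquivalence = record
      { refl  = λ {x} → ≗⇒≈ {x} {x} λ _ → refl
      ; sym   = λ {x} {y} → ≈-sym {x} {y}
      ; trans = λ {x} {y} {z} → ≈-trans {x} {y} {z}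
      }
    ; reflexive = λ {x} {y} → ≈⇒≤ {x} {y}
    ; trans     = λ {x} {y} {z} → ≤-trans {x} {y} {z}
    }
  }

+-identityˡ : ∀ x → 0ᴿ +ᴿ x ≈ᴿ x
+-identityˡ x = ≗⇒≈ {0ᴿ +ᴿ x} {x} λ n → ℚ.+-identityˡ (seq x n)

+-identityʳ : ∀ x → x +ᴿ 0ᴿ ≈ᴿ x
+-identityʳ x = ≗⇒≈ {x +ᴿ 0ᴿ} {x} λ n → ℚ.+-identityʳ (seq x n)

-- Limits of sequences and series of reals

∣p-r∣≤∣p-q∣+∣q-r∣ : ∀ p q r → ℚ.∣ p ℚ.- r ∣ ℚ.≤ ℚ.∣ p ℚ.- q ∣ ℚ.+ ℚ.∣ q ℚ.- r ∣
∣p-r∣≤∣p-q∣+∣q-r∣ p q r = subst (λ t → ℚ.∣ t ∣ ℚ.≤ ℚ.∣ p ℚ.- q ∣ ℚ.+ ℚ.∣ q ℚ.- r ∣)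
  (solve 3 (λ p q r → (p :+ (:- q)) :+ (q :+ (:- r)) := p :+ (:- r)) refl p q r)
  (ℚ.∣p+q∣≤∣p∣+∣q∣ (p ℚ.- q) (q ℚ.- r))
  where open +-*-Solver

-- A limit of s is close to s n for large n, but the defining inequality is
-- itself only approximate, so half of ε pays for the comparison of sequences.
limit-close : ∀ {s l} → ConvergesTo s l → ∀ ε → 0ℚ ℚ.< ε →
              ∃ λ N → ∀ n → N ℕ.≤ n →
              ∃ λ K → ∀ k → K ℕ.≤ k → ℚ.∣ seq (s n) k ℚ.- seq l k ∣ ℚ.< ε
limit-close {s} {l} s→l ε 0<ε =
  let N , p = s→l (½ ℚ.* ε) (½-pos 0<ε)
  in N , λ n N≤n →
    let K , q = p n N≤n (½ ℚ.* ε) (½-pos 0<ε)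
    in K , λ k K≤k → subst (ℚ.∣ seq (s n) k ℚ.- seq l k ∣ ℚ.<_) (½ε+½ε≡ε ε) (q k K≤k)

-- One term `s n` beyond both thresholds lies within ε/2 of `l` and of `c`. This evaluates a series
-- whose terms vanish from some point on.
limit-of-eventually-≈ : ∀ {s l c} N → (∀ n → N ℕ.≤ n → s n ≈ᴿ c) → ConvergesTo s l → l ≈ᴿ c
limit-of-eventually-≈ {s} {l} {c} N s≈c s→l ε 0<ε =
  let M , p = limit-close {s} {l} s→l (½ ℚ.* ε) (½-pos 0<ε)
      -- The term is fixed first; only then does the index `k` of the approximating rationals vary.
      n = N ℕ.⊔ M
      K , q = p n (ℕ.m≤n⊔m N M)
      J , r = s≈c n (ℕ.m≤m⊔n N M) (½ ℚ.* ε) (½-pos 0<ε)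
  in K ℕ.⊔ J , λ k K⊔J≤k → begin-strict
    ℚ.∣ seq l k ℚ.- seq c k ∣
      ≤⟨ ∣p-r∣≤∣p-q∣+∣q-r∣ (seq l k) (seq (s n) k) (seq c k) ⟩
    ℚ.∣ seq l k ℚ.- seq (s n) k ∣ ℚ.+ ℚ.∣ seq (s n) k ℚ.- seq c k ∣
      ≡⟨ cong (ℚ._+ ℚ.∣ seq (s n) k ℚ.- seq c k ∣) (∣p-q∣≡∣q-p∣ (seq l k) (seq (s n) k)) ⟩
    ℚ.∣ seq (s n) k ℚ.- seq l k ∣ ℚ.+ ℚ.∣ seq (s n) k ℚ.- seq c k ∣
      <⟨ ℚ.+-mono-< (q k (ℕ.m⊔n≤o⇒m≤o K J K⊔J≤k)) (r k (ℕ.m⊔n≤o⇒n≤o K J K⊔J≤k)) ⟩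
    ½ ℚ.* ε ℚ.+ ½ ℚ.* ε
      ≡⟨ ½ε+½ε≡ε ε ⟩
    ε ∎
  where open ℚ.≤-Reasoning

-- Two consecutive partial sums differ by `x`, and both are eventually within ε/2 of the limit. The
-- value of the limit does not matter.
convergent-const-series⇒0 : ∀ {x l} → ConvergesTo (partialSum λ _ → x) l → x ≈ᴿ 0ᴿ
convergent-const-series⇒0 {x} {l} s→l ε 0<ε =
  let N , p = limit-close {partialSum λ _ → x} {l} s→l (½ ℚ.* ε) (½-pos 0<ε)
      K , q = p (suc N) (ℕ.n≤1+n N)
      J , r = p N ℕ.≤-refl
  in K ℕ.⊔ J , λ k K⊔J≤k → let t = seq (partialSum (λ _ → x) N) k in begin-strict
    ℚ.∣ seq x k ℚ.- 0ℚ ∣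
      ≡⟨ cong ℚ.∣_∣ (solve 2 (λ t x → x :+ (:- con 0ℚ) := (t :+ x) :+ (:- t)) refl t (seq x k)) ⟩
    ℚ.∣ (t ℚ.+ seq x k) ℚ.- t ∣
      ≤⟨ ∣p-r∣≤∣p-q∣+∣q-r∣ (t ℚ.+ seq x k) (seq l k) t ⟩
    ℚ.∣ (t ℚ.+ seq x k) ℚ.- seq l k ∣ ℚ.+ ℚ.∣ seq l k ℚ.- t ∣
      ≡⟨ cong (ℚ.∣ (t ℚ.+ seq x k) ℚ.- seq l k ∣ ℚ.+_) (∣p-q∣≡∣q-p∣ (seq l k) t) ⟩
    ℚ.∣ (t ℚ.+ seq x k) ℚ.- seq l k ∣ ℚ.+ ℚ.∣ t ℚ.- seq l k ∣
      <⟨ ℚ.+-mono-< (q k (ℕ.m⊔n≤o⇒m≤o K J K⊔J≤k)) (r k (ℕ.m⊔n≤o⇒n≤o K J K⊔J≤k)) ⟩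
    ½ ℚ.* ε ℚ.+ ½ ℚ.* ε
      ≡⟨ ½ε+½ε≡ε ε ⟩
    ε ∎
  where
  open ℚ.≤-Reasoning
  open +-*-Solver using (solve; _:=_; _:+_; :-_; con)

open import Relation.Binary.Reasoning.Preorder ℝ-preorder

-- Finite additivity and monotonicity of μ

module Measure (P : ProbabilitySpace a e) where
  open ProbabilitySpace P

  ∅-event : IsEvent ∅
  ∅-event = resp ((λ ¬U → ¬U _) , λ ()) (∁-event U-event)

  -- The constant sequence ∅, ∅, ... is pairwise disjoint, so countable additivity makes the
  -- constant series of `μ ∅` converge.
  μ-∅ : μ ∅ ∅-event ≈ᴿ 0ᴿ
  μ-∅ = convergent-const-series⇒0 {μ ∅ ∅-event} {μ (⋃ ℕ λ _ → ∅) (⋃-event λ _ → ∅-event)}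
    (μ-additive (λ _ → ∅-event) λ _ _ _ → proj₁)

  infixr 5 _∪∅_

  -- Padding with ∅ turns a binary union into a countable one, to which `μ-additive` applies.
  _∪∅_ : Pred Ω 0ℓ → Pred Ω 0ℓ → ℕ → Pred Ω 0ℓ
  (A ∪∅ B) 0             = A
  (A ∪∅ B) 1             = B
  (A ∪∅ B) (suc (suc _)) = ∅

  module _ {A B : Pred Ω 0ℓ} (p : IsEvent A) (q : IsEvent B) where

    ∪∅-event : ∀ i → IsEvent ((A ∪∅ B) i)
    ∪∅-event 0             = p
    ∪∅-event 1             = q
    ∪∅-event (suc (suc _)) = ∅-event

    ⋃∪∅≐∪ : ⋃ ℕ (A ∪∅ B) ≐ A ∪ B
    ⋃∪∅≐∪ = (λ { (0 , x) → inj₁ x ; (1 , y) → inj₂ y })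
          , (λ { (inj₁ x) → 0 , x ; (inj₂ y) → 1 , y })

    ∪-event : IsEvent (A ∪ B)
    ∪-event = resp ⋃∪∅≐∪ (⋃-event ∪∅-event)

    ∪∅-disjoint : A ⊥ B → ∀ i j → i ≢ j → (A ∪∅ B) i ⊥ (A ∪∅ B) j
    ∪∅-disjoint A⊥B 0 0 i≢j _ = i≢j refl
    ∪∅-disjoint A⊥B 0 1 _ h = A⊥B h
    ∪∅-disjoint A⊥B 0 (suc (suc _)) _ (_ , ())
    ∪∅-disjoint A⊥B 1 0 _ (y , x) = A⊥B (x , y)
    ∪∅-disjoint A⊥B 1 1 i≢j _ = i≢j refl
    ∪∅-disjoint A⊥B 1 (suc (suc _)) _ (_ , ())
    ∪∅-disjoint A⊥B (suc (suc _)) _ _ (() , _)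

    partialSum-∪∅ : ∀ n → 2 ℕ.≤ n →
      partialSum (λ i → μ ((A ∪∅ B) i) (∪∅-event i)) n ≈ᴿ μ A p +ᴿ μ B q
    partialSum-∪∅ 1 (ℕ.s≤s ())
    -- Partial sums start at `0ᴿ`, so the second one is `(0ᴿ +ᴿ μ A p) +ᴿ μ B q`.
    partialSum-∪∅ 2 _ = +-cong {0ᴿ +ᴿ μ A p} {μ A p} {μ B q} {μ B q}
      (+-identityˡ (μ A p)) (Preorder.Eq.refl ℝ-preorder {μ B q})
    partialSum-∪∅ (suc n@(suc (suc _))) _ = begin-equality
      s +ᴿ μ ∅ ∅-event        ≈⟨ +-cong {s} {c} {μ ∅ ∅-event} {0ᴿ} (partialSum-∪∅ n (ℕ.s≤s (ℕ.s≤s ℕ.z≤n))) μ-∅ ⟩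
      c +ᴿ 0ᴿ                 ≈⟨ +-identityʳ c ⟩
      c                       ∎
      where
      s c : ℝ
      s = partialSum (λ i → μ ((A ∪∅ B) i) (∪∅-event i)) n
      c = μ A p +ᴿ μ B q

    -- The series for the padded sequence is constant from its second partial sum on, so its limit
    -- is that constant.
    μ-∪ : A ⊥ B → μ (A ∪ B) ∪-event ≈ᴿ μ A p +ᴿ μ B q
    μ-∪ A⊥B = begin-equality
      μ (A ∪ B) ∪-event
        ≈⟨ μ-cong (⋃-event ∪∅-event) ∪-event ⋃∪∅≐∪ ⟨
      μ (⋃ ℕ (A ∪∅ B)) (⋃-event ∪∅-event)
        ≈⟨ limit-of-eventually-≈ {partialSum (λ i → μ ((A ∪∅ B) i) (∪∅-event i))}
             {μ (⋃ ℕ (A ∪∅ B)) (⋃-event ∪∅-event)} {μ A p +ᴿ μ B q}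
             2 partialSum-∪∅ (μ-additive ∪∅-event (∪∅-disjoint A⊥B)) ⟩
      μ A p +ᴿ μ B q ∎

  -- `B` is the disjoint union of `A` and `B ∩ ∁ A`, and the latter has nonnegative measure.
  -- Deciding `A` gives the splitting; deciding both makes the difference an event.
  μ-mono : ∀ {A B} → Decidable A → Decidable B → (p : IsEvent A) (q : IsEvent B) →
           A ⊆ᵖ B → μ A p ≤ᴿ μ B q
  μ-mono {A} {B} A? B? p q A⊆B = begin
    μ A p                       ≈⟨ +-identityʳ (μ A p) ⟨
    μ A p +ᴿ 0ᴿ                 ≲⟨ +-mono-≤ {μ A p} {μ A p} {0ᴿ} {μ (B ∩ ∁ A) r}
                                     (Preorder.refl ℝ-preorder {μ A p}) (μ-nonneg r) ⟩
    μ A p +ᴿ μ (B ∩ ∁ A) r      ≈⟨ μ-∪ p r (λ (x , _ , ¬x) → ¬x x) ⟨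
    μ (A ∪ B ∩ ∁ A) (∪-event p r) ≈⟨ μ-cong (∪-event p r) q (to , from) ⟩
    μ B q                       ∎
    where
    r : IsEvent (B ∩ ∁ A)
    r = ∩-event 𝓕 B? (λ ω → ¬? (A? ω)) q (∁-event p)

    to : A ∪ B ∩ ∁ A ⊆ᵖ B
    to (inj₁ x)       = A⊆B x
    to (inj₂ (y , _)) = y

    from : B ⊆ᵖ A ∪ B ∩ ∁ A
    from {ω} y with A? ω
    ... | yes x = inj₁ x
    ... | no ¬x = inj₂ (y , ¬x)

  -- Finite disjoint unions indexed by lists

  module _ {X : Set} {E : X → Pred Ω 0ℓ} (E-event : ∀ x → IsEvent (E x)) where

    AnyOf : List X → Pred Ω 0ℓ
    AnyOf xs ω = Any (λ x → E x ω) xs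

    Any-event : ∀ xs → IsEvent (AnyOf xs)
    Any-event []       = resp ((λ ()) , λ ()) ∅-event
    Any-event (x ∷ xs) = resp (Any.fromSum , Any.toSum) (∪-event (E-event x) (Any-event xs))

    -- f is separate from λ x → μ (E x) (E-event x): comparing the two under ∑
    -- by conversion would unfold the Cauchy proofs inside _+ᴿ_.
    ∑-μ : ∀ (f : X → ℝ) → (∀ x → f x ≈ᴿ μ (E x) (E-event x)) →
          {R : Rel X 0ℓ} → (∀ {x y} → R x y → E x ⊥ E y) →
          ∀ {xs} → AllPairs R xs → ∑ xs f ≈ᴿ μ (AnyOf xs) (Any-event xs)
    ∑-μ f f≈μ R⇒⊥ [] = begin-equality
      0ᴿ                          ≈⟨ μ-∅ ⟨
      μ ∅ ∅-event                 ≈⟨ μ-cong ∅-event (Any-event []) ((λ ()) , λ ()) ⟩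
      μ (AnyOf []) (Any-event []) ∎
    ∑-μ f f≈μ R⇒⊥ {x ∷ xs} (x∼xs ∷ xs∼) = begin-equality
      f x +ᴿ ∑ xs f
        ≈⟨ +-cong {f x} {μ (E x) (E-event x)} {∑ xs f} {μ (AnyOf xs) (Any-event xs)}
             (f≈μ x) (∑-μ f f≈μ R⇒⊥ xs∼) ⟩
      μ (E x) (E-event x) +ᴿ μ (AnyOf xs) (Any-event xs)
        ≈⟨ μ-∪ (E-event x) (Any-event xs)
             -- A point in the head event and in a later one contradicts the relation `R` that
             -- `AllPairs` records between these two entries.
             (λ (h , any) → let r , k = All.lookupAny x∼xs any in R⇒⊥ r (h , k)) ⟨
      μ (E x ∪ AnyOf xs) (∪-event (E-event x) (Any-event xs))
        ≈⟨ μ-cong (∪-event (E-event x) (Any-event xs)) (Any-event (x ∷ xs))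
             (Any.fromSum , Any.toSum) ⟩
      μ (AnyOf (x ∷ xs)) (Any-event (x ∷ xs)) ∎

-- Finite sets of symbols

χ-∈ : ∀ {A j} → j ∈ A → χ A j ≡ true
χ-∈ {A} {j} j∈A = trans (isYes≗does (j ∈? A)) (dec-true (j ∈? A) j∈A)

χ-∉ : ∀ {A j} → j ∉ A → χ A j ≡ false
χ-∉ {A} {j} j∉A = trans (isYes≗does (j ∈? A)) (dec-false (j ∈? A) j∉A)

χ-∷ : ∀ {j k} S → k ≢ j → χ (j ∷ S) k ≡ χ S k
χ-∷ {j} {k} S k≢j = trans (isYes≗does (k ∈? (j ∷ S)))
  (trans (does-⇔ (mk⇔ (Any.tail k≢j) there) (k ∈? (j ∷ S)) (k ∈? S)) (sym (isYes≗does (k ∈? S))))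

∩ᵛ-∈ : ∀ v {A j} → j ∈ A → (v ∩ᵛ A) j ≡ v j
∩ᵛ-∈ v {A} {j} j∈A = trans (cong (v j ∧_) (χ-∈ j∈A)) (∧-identityʳ (v j))

-- A canonical list for v ∩ A: filtering keeps the order of `A`, which is also the order used by
-- `subsets`, so it occurs there as a list and not merely up to extensionality.
trues : Valuation → List ℕ → List ℕ
trues v = filter (T? ∘ v)

χ-trues : ∀ v A → χ (trues v A) ≗ v ∩ᵛ A
χ-trues v A j = trans (isYes≗does (j ∈? trues v A))
  (trans (does-⇔ (mk⇔ to from) (j ∈? trues v A) (T? (v j) ×-dec (j ∈? A)))
         (cong (v j ∧_) (sym (isYes≗does (j ∈? A)))))
  where
  to : j ∈ trues v A → T (v j) × j ∈ A
  to h = let j∈A , t = ∈-filter⁻ (T? ∘ v) h in t , j∈A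

  from : T (v j) × j ∈ A → j ∈ trues v A
  from (t , j∈A) = ∈-filter⁺ (T? ∘ v) j∈A t

trues∈subsets : ∀ v A → trues v A ∈ subsets A
trues∈subsets v []      = here refl
trues∈subsets v (j ∷ A) with T? (v j)
... | yes t = subst (_∈ subsets (j ∷ A)) (sym (filter-accept (T? ∘ v) t))
                (∈-++⁺ʳ (subsets A) (∈-map⁺ (j ∷_) (trues∈subsets v A)))
... | no ¬t = subst (_∈ subsets (j ∷ A)) (sym (filter-reject (T? ∘ v) ¬t))
                (∈-++⁺ˡ (trues∈subsets v A))

subsets⇒⊆ : ∀ {A S} → S ∈ subsets A → S ⊆ A
subsets⇒⊆ {[]}    (here refl) ()
subsets⇒⊆ {j ∷ A} S∈ k∈S with ∈-++⁻ (subsets A) S∈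
... | inj₁ S∈A = there (subsets⇒⊆ S∈A k∈S)
... | inj₂ S∈j∷A with ∈-map⁻ (j ∷_) S∈j∷A
...   | R , R∈A , refl with k∈S
...     | here k≡j  = here k≡j
...     | there k∈R = there (subsets⇒⊆ R∈A k∈R)

-- Stronger than `R ≢ S`: the difference must show at a symbol of `A`, since the cylinders over `A`
-- only test such symbols.
Separated : List ℕ → List ℕ → List ℕ → Set
Separated A R S = ∃ λ j → j ∈ A × χ R j ≢ χ S j

-- Two subsets that both omit `j`, or both contain it, are separated by induction; a subset without
-- `j` and one with `j` are separated at `j` itself.
subsets-separated : ∀ {A} → Unique A → AllPairs (Separated A) (subsets A)
subsets-separated {[]}    []          = [] ∷ []
subsets-separated {j ∷ A} (j∉A ∷ A!) = AllPairs.++⁺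
  (AllPairs.map (λ (k , k∈A , h) → k , there k∈A , h) rec)
  (AllPairs.map⁺ (AllPairs.map keep rec))
  (All.tabulate λ R∈A → All.tabulate λ S∈j∷A → new R∈A S∈j∷A)
  where
  rec : AllPairs (Separated A) (subsets A)
  rec = subsets-separated A!

  keep : ∀ {R S} → Separated A R S → Separated (j ∷ A) (j ∷ R) (j ∷ S)
  -- The old separating symbol `k` differs from `j`, as `A` does not contain `j`, so prepending `j`
  -- leaves membership of `k` unchanged.
  keep {R} {S} (k , k∈A , h) = k , there k∈A , λ eq →
    h (trans (sym (χ-∷ R k≢j)) (trans eq (χ-∷ S k≢j)))
    where
    k≢j : k ≢ j
    k≢j k≡j = All.lookup j∉A k∈A (sym k≡j)

  new : ∀ {R S} → R ∈ subsets A → S ∈ map (j ∷_) (subsets A) → Separated (j ∷ A) R S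
  new {R} {S} R∈A S∈j∷A with ∈-map⁻ (j ∷_) S∈j∷A
  ... | S′ , _ , refl = j , here refl , λ eq → false≢true
    (trans (sym (χ-∉ {R} λ j∈R → All.lookup j∉A (subsets⇒⊆ R∈A j∈R) refl))
           (trans eq (χ-∈ {j ∷ S′} (here refl))))
    where
    false≢true : false ≢ true
    false≢true ()

-- Satisfaction

-- One implication suffices as induction hypothesis: agreement is symmetric, so at negative
-- positions it is applied with `v` and `w` exchanged.
⊩-resp : ∀ {v w} α → (∀ {j} → j ∈ occurrences α → v j ≡ w j) → v ⊩ α → w ⊩ α
⊩-resp (atom j) h   = subst T (h (here refl))
⊩-resp (∼ α)    h f = f ∘ ⊩-resp α (sym ∘ h)
⊩-resp (α ⊃ β)  h f =
  ⊩-resp β (h ∘ ∈-++⁺ʳ (occurrences α)) ∘ f ∘ ⊩-resp α (sym ∘ h ∘ ∈-++⁺ˡ)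

-- The event that a formula is true under the random valuation

module Truth {P : ProbabilitySpace a e} (𝐕 : StochasticValuation P) where
  open ProbabilitySpace P
  open StochasticValuation 𝐕
  open Measure P

  sample : Ω → Valuation
  sample ω j = V j ω

  Truth : L → Pred Ω 0ℓ
  Truth α ω = sample ω ⊩ α

  Truth? : ∀ α → Decidable (Truth α)
  Truth? α ω = sample ω ⊩? α

  -- An implication is the complement of `α` holding while `β` fails; decidability of satisfaction
  -- removes the double negation.
  Truth-event : ∀ α → IsEvent (Truth α)
  Truth-event (atom j) = resp (Equivalence.from T-≡ , Equivalence.to T-≡) (measurable j true)
  Truth-event (∼ α)    = ∁-event (Truth-event α)
  Truth-event (α ⊃ β)  = resp
    ( (λ {ω} h x → decidable-stable (Truth? β ω) λ ¬y → h (x , ¬y))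
    , (λ f (x , ¬y) → ¬y (f x)))
    (∁-event (∩-event 𝓕 (Truth? α) (Truth? (∼ β)) (Truth-event α) (∁-event (Truth-event β))))

  cylinder-disjoint : ∀ {A R S} → Separated A R S → cylinder 𝐕 A R ⊥ cylinder 𝐕 A S
  cylinder-disjoint (j , j∈A , h) (r , s) =
    h (trans (sym (All.lookup r j∈A)) (All.lookup s j∈A))

  module _ (α : L) where

    private
      A : List ℕ
      A = symbols α

    models : List (List ℕ)
    models = filter ⟦ α ⟧? (subsets A)

    SomeCylinder : Pred Ω 0ℓ
    SomeCylinder = AnyOf (cylinder-event 𝐕 A) models

    SomeCylinder-event : IsEvent SomeCylinder
    SomeCylinder-event = Any-event (cylinder-event 𝐕 A) models

    -- On the symbols of `α` the sample agrees with `χ S`, and `χ S` with a valuation satisfying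
    -- `α`.
    SomeCylinder⇒Truth : SomeCylinder ⊆ᵖ Truth α
    SomeCylinder⇒Truth any
      with S , S∈ , cyl ← find any
      with _ , v , v⊩α , χS≗ ← ∈-filter⁻ ⟦ α ⟧? {xs = subsets A} S∈ =
      ⊩-resp α (λ {j} j∈α → let j∈A = ∈-deduplicate⁺ ℕ._≟_ j∈α in
        sym (trans (All.lookup cyl j∈A) (trans (χS≗ j) (∩ᵛ-∈ v j∈A)))) v⊩α

    -- The sample itself supplies the cylinder: take the symbols of `α` that it makes true.
    Truth⇒SomeCylinder : Truth α ⊆ᵖ SomeCylinder
    Truth⇒SomeCylinder {ω} sat = lose
      (∈-filter⁺ ⟦ α ⟧? (trues∈subsets v A) (v , sat , χ-trues v A))
      (All.tabulate λ {j} j∈A → sym (trans (χ-trues v A j) (∩ᵛ-∈ v j∈A)))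
      where
      v : Valuation
      v = sample ω

    models-separated : AllPairs (Separated A) models
    models-separated = AllPairs.filter⁺ ⟦ α ⟧?
      (subsets-separated (deduplicate-! ℕ._≟_ (occurrences α)))

    Prob≈μ : Prob 𝐕 α ≈ᴿ μ (Truth α) (Truth-event α)
    Prob≈μ = begin-equality
      Prob 𝐕 α
        ≈⟨ ∑-μ (cylinder-event 𝐕 A) (λ S → ℙ[V_≡_] 𝐕 (symbols α) S)
             (λ S → Preorder.Eq.refl ℝ-preorder {ℙ[V_≡_] 𝐕 A S})
             (λ {R} {S} → cylinder-disjoint {A} {R} {S}) models-separated ⟩
      μ SomeCylinder SomeCylinder-event
        ≈⟨ μ-cong SomeCylinder-event (Truth-event α) (SomeCylinder⇒Truth , Truth⇒SomeCylinder) ⟩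
      μ (Truth α) (Truth-event α) ∎

-- The four axioms, transferred from `μ` to `Prob`

theorem2p7 : {a e : Level} (P : ProbabilitySpace a e) (𝐕 : StochasticValuation P) → IsProbabilityAssignment (Prob 𝐕)
theorem2p7 P 𝐕 = record
  { P1 = λ α →
      (begin
        0ᴿ         ≲⟨ μ-nonneg (Truth-event α) ⟩
        m α        ≈⟨ Prob≈μ α ⟨
        Prob 𝐕 α   ∎) ,
      (begin
        Prob 𝐕 α     ≈⟨ Prob≈μ α ⟩
        m α          ≲⟨ μ-mono (Truth? α) (λ _ → yes _) (Truth-event α) U-event _ ⟩
        μ U U-event  ≈⟨ μ-U ⟩
        1ᴿ           ∎)
  ; P2 = λ α ⊨α → begin-equality
      Prob 𝐕 α     ≈⟨ Prob≈μ α ⟩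
      m α          ≈⟨ μ-cong (Truth-event α) U-event (_ , λ {ω} _ → ⊨α (sample ω) λ _ ()) ⟩
      μ U U-event  ≈⟨ μ-U ⟩
      1ᴿ           ∎
  ; P3 = λ α β α⊨β → begin
      Prob 𝐕 α   ≈⟨ Prob≈μ α ⟩
      m α        ≲⟨ μ-mono (Truth? α) (Truth? β) (Truth-event α) (Truth-event β)
                      (λ {ω} x → α⊨β (sample ω) λ { _ refl → x }) ⟩
      m β        ≈⟨ Prob≈μ β ⟨
      Prob 𝐕 β   ∎
  ; P4 = λ α β ⊨¬β∧α → begin-equality
      Prob 𝐕 (β ∨ᴸ α)
        ≈⟨ Prob≈μ (β ∨ᴸ α) ⟩
      m (β ∨ᴸ α)
        ≈⟨ μ-cong (Truth-event (β ∨ᴸ α)) (∪-event (Truth-event β) (Truth-event α))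
             -- `β ∨ᴸ α` unfolds to `∼ β ⊃ α`; reading it as a union relies on deciding `Truth β`.
             (to α β , λ { (inj₁ y) ¬y → ⊥-elim (¬y y) ; (inj₂ x) _ → x }) ⟩
      μ _ (∪-event (Truth-event β) (Truth-event α))
        ≈⟨ μ-∪ (Truth-event β) (Truth-event α)
             -- `∼ (β ∧ᴸ α)` unfolds to a double negation of `β ⊃ ∼ α`, which joint truth of `β` and
             -- `α` refutes.
             (λ {ω} (y , x) → ⊨¬β∧α (sample ω) (λ _ ()) λ f → f y x) ⟩
      m β +ᴿ m α
        ≈⟨ +-cong {Prob 𝐕 β} {m β} {Prob 𝐕 α} {m α} (Prob≈μ β) (Prob≈μ α) ⟨
      Prob 𝐕 β +ᴿ Prob 𝐕 α ∎
  }
  where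
  open ProbabilitySpace P
  open Measure P
  open Truth 𝐕

  m : L → ℝ
  m α = μ (Truth α) (Truth-event α)

  to : ∀ α β → Truth (β ∨ᴸ α) ⊆ᵖ Truth β ∪ Truth α
  to α β {ω} f with Truth? β ω
  ... | yes y = inj₁ y
  ... | no ¬y = inj₂ (f ¬y)
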